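{- For any positive integer $m$, there exists a non-mid-point reducible subset $S\subseteq \mathbb{Z}_m^2$ of size $|S|\ge \frac{7}{24}\cdot m^2$.
   Context: $\mathbb{Z}_m=\mathbb{Z}/m\mathbb{Z}$ denotes the integers modulo $m$. For a subset $S\subseteq \mathbb{Z}_m^d$, a point $y\in S$ is called a non-mid-point of $S$ if there is no solution to the equation $2y=x+z$ with distinct $x,z\in S$. A subset $S\subseteq \mathbb{Z}_m^d$ is called non-mid-point reducible if for every non-empty subset $S'\subseteq S$, some point $y\in S'$ is a non-mid-point of $S'$. -}

module Defs where

open import Data.Fin using (Fin; toℕ)
open import Data.List using (List; length)
import Data.List.Membership.Propositional as List
open import Data.List.Relation.Unary.Unique.Propositional using (Unique)
open import Data.Nat as ℕ using (ℕ; NonZero)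
open import Data.Nat.DivMod using (_mod_)
open import Data.Product using (∃; _×_)
open import Data.Vec using (Vec; zipWith)
open import Relation.Binary.PropositionalEquality using (_≡_; _≢_)
open import Relation.Nullary using (¬_)

-- Residue classes modulo m are represented by 0, …, m - 1, so that
-- equality in ℤ_m is propositional equality.
ℤ/ : ℕ → Set
ℤ/ m = Fin m

infixl 6 _+ₘ_ _⊕_

_+ₘ_ : ∀ {m} .{{_ : NonZero m}} → ℤ/ m → ℤ/ m → ℤ/ m
_+ₘ_ {m} i j = (toℕ i ℕ.+ toℕ j) mod m

ℤPow : ℕ → ℕ → Set
ℤPow m d = Vec (ℤ/ m) d

_⊕_ : ∀ {m d} .{{_ : NonZero m}} → ℤPow m d → ℤPow m d → ℤPow m d
_⊕_ = zipWith _+ₘ_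

-- Finite subsets are lists without repetition, so the length is the
-- cardinality.  Only membership and length are used, never the order.
record FinSubset (A : Set) : Set where
  field
    elements : List A
    unique   : Unique elements

open FinSubset public

infix 4 _∈_ _⊆_

_∈_ : ∀ {A} → A → FinSubset A → Set
x ∈ S = x List.∈ elements S

_⊆_ : ∀ {A} → FinSubset A → FinSubset A → Set
S ⊆ T = ∀ {x} → x ∈ S → x ∈ T

Nonempty : ∀ {A} → FinSubset A → Set
Nonempty S = ∃ λ x → x ∈ S

∣_∣ : ∀ {A} → FinSubset A → ℕ
∣ S ∣ = length (elements S)

module _ {m d : ℕ} .{{_ : NonZero m}} where

  NonMidPoint : FinSubset (ℤPow m d) → ℤPow m d → Set
  NonMidPoint S y =
    y ∈ S ×
    ¬ (∃ λ x → ∃ λ z → x ∈ S × z ∈ S × x ≢ z × y ⊕ y ≡ x ⊕ z)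

  NonMidPointReducible : FinSubset (ℤPow m d) → Set
  NonMidPointReducible S =
    ∀ (S′ : FinSubset (ℤPow m d)) → S′ ⊆ S → Nonempty S′ →
    ∃ λ y → NonMidPoint S′ y

{-# OPTIONS --safe #-}
module Submission where

-- Let T be the region of the fine grid [0, 24 m) × [0, 16 m) whose rows are
-- as follows.  For y < 8 m, row y is an interval centred at 9 m whose half
-- width is m + y, capped at 6 m.  For y ≥ 8 m, row y is a pair of intervals
-- centred at 3 m and 15 m, that is, shifted by half a period, with half width
-- 13 m - y, capped at 3 m.  Doubling maps such a pair two-to-one, which is what
-- beats the density 1/4 of a box: T has at least 113 m² points, and
-- 112/384 = 7/24.
--
-- If 2 y = x + z in T modulo (24 m, 16 m) with x ≠ z, then y lies lower than x
-- or z in the order that compares rows first and then columns (modulo half a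
-- period in the upper rows).  Indeed, the only other possibility is that the
-- rows wrap around once, but the widths are chosen so that then the doubled row
-- of y misses the sum of the rows of x and z.  So the highest point of any
-- subset is a non-mid-point.  The grid consists of 24 · 16 translates of ℤ_m²,
-- and by averaging one of them meets T in at least 7/24 · m² points.

open import Defs
open import Data.Bool using (if_then_else_)
open import Data.Empty using (⊥; ⊥-elim)
open import Data.Fin using (Fin; zero; suc; toℕ)
open import Data.Fin.Properties using (toℕ-fromℕ<; toℕ-injective; toℕ<n)
open import Data.List using ([]; _∷_; _++_; length; map; filter; tabulate; allFin; cartesianProductWith)
open import Data.List.Extrema.Nat using (argmax; argmax-sel; f[xs]≤f[argmax])
open import Data.List.Membership.Propositional.Properties using (∈-filter⁻)
open import Data.List.Properties using (length-++; filter-++; map-tabulate)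
open import Data.List.Relation.Unary.All as All using ()
import Data.List.Relation.Unary.Unique.Propositional.Properties as Unique
open import Data.Nat using (ℕ; NonZero; zero; suc; _+_; _*_; _^_; _∸_; _≤_; _<_; _/_; _%_; s≤s; z≤n; z<s; s<s; _<?_; _≤?_; compare; less; equal; greater)
open import Data.Nat.DivMod using (m≡m%n+[m/n]*n; m%n≤m; m<n⇒m%n≡m; [m+n]%n≡m%n; m%n<n; m<n*o⇒m/o<n)
open import Data.Nat.Properties
open import Data.Nat.Tactic.RingSolver using (solve)
open import Data.Product using (Σ; ∃; ∃₂; _×_; _,_; proj₁; proj₂)
open import Data.Sum as Sum using (_⊎_; inj₁; inj₂; [_,_]′)
import Data.Vec as Vec
open import Function using (_∘_; id)
open import Relation.Binary.PropositionalEquality using (_≡_; _≢_; refl; sym; trans; cong; cong₂; subst; module ≡-Reasoning)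
open import Relation.Nullary using (¬_; Dec; yes; no; does; contradiction)
open import Relation.Nullary.Decidable using (_×-dec_; _⊎-dec_)
open import Relation.Unary using (Pred; Decidable)

-- Linear inequalities are refuted by adding up hypotheses (a Farkas
-- certificate) and comparing the two sums with the ring solver.  They are
-- abstract because unfolding the solver's proofs exhausts the memory.
abstract

  sum-absurd : ∀ {A B k} → A ≤ B → A ≡ suc k + B → ⊥
  sum-absurd {B = B} {k} A≤B refl = <⇒≱ (s≤s (m≤n+m B k)) A≤B

  sum-≤ : ∀ {a b A B k} → A ≤ B → A + suc b ≡ suc k + (B + a) → a ≤ b
  sum-≤ {k = k} A≤B eq = ≮⇒≥ λ b<a → sum-absurd {k = k} (+-mono-≤ A≤B b<a) eq

  sum-< : ∀ {a b A B k} → A ≤ B → A + b ≡ suc k + (B + a) → a < b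
  sum-< {k = k} A≤B eq = ≰⇒> λ b≤a → sum-absurd {k = k} (+-mono-≤ A≤B b≤a) eq

infixl 6 _⊞_

_⊞_ : ∀ {a b c d} → a ≤ b → c ≤ d → a + c ≤ b + d
_⊞_ = +-mono-≤

-- Equations modulo a period

module _ {A B : ℕ} (D : ℕ) where

  private
    excess : ∀ {A B} p k → A + D * p ≡ B + D * suc (p + k) → A ≡ B + D + D * k
    excess {A} {B} p k eq = +-cancelʳ-≡ (D * p) A (B + D + D * k) (trans eq (solve (B ∷ D ∷ p ∷ k ∷ [])))

  -- If `p` and `q` differed, `A` and `B` would be at least a full period apart. The agreement of
  -- the multipliers later carries the parity of column quotients.
  cancel-multiples : ∀ p q → A + D * p ≡ B + D * q → A < B + D → B < A + D → A ≡ B × p ≡ q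
  cancel-multiples p q eq A<B+D B<A+D with compare p q
  ... | less p k = contradiction A<B+D
    (≤⇒≯ (≤-trans (m≤m+n (B + D) (D * k)) (≤-reflexive (sym (excess p k eq)))))
  ... | equal p = +-cancelʳ-≡ (D * p) A B eq , refl
  ... | greater q k = contradiction B<A+D
    (≤⇒≯ (≤-trans (m≤m+n (A + D) (D * k)) (≤-reflexive (sym (excess q k (sym eq))))))

  -- The difference `B - A` is a multiple of `D` lying strictly between `- D` and `2 D`, so it is 0
  -- or `D`.
  wraps-at-most-once : ∀ p q → A + D * p ≡ B + D * q → A < B + D → B < D + D → A ≡ B ⊎ A + D ≡ B
  wraps-at-most-once p q eq A<B+D B<2D with compare p q
  ... | less p k = contradiction A<B+D
    (≤⇒≯ (≤-trans (m≤m+n (B + D) (D * k)) (≤-reflexive (sym (excess p k eq)))))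
  ... | equal p = inj₁ (+-cancelʳ-≡ (D * p) A B eq)
  ... | greater q zero = inj₂ (sym (trans (excess q zero (sym eq))
    (trans (cong (A + D +_) (*-zeroʳ D)) (+-identityʳ (A + D)))))
  ... | greater q (suc k) = contradiction B<2D
    (≤⇒≯ (≤-trans (+-mono-≤ (m≤n+m D A) (m≤m*n D (suc k))) (≤-reflexive (sym (excess q (suc k) (sym eq))))))

≤-mid⇒≡ : ∀ {x y z} → y + y ≤ x + z → x ≤ y → z ≤ y → x ≡ y × z ≡ y
≤-mid⇒≡ {x} {y} {z} 2y≤x+z x≤y z≤y =
  ≤-antisym x≤y (+-cancelʳ-≤ y y x (≤-trans 2y≤x+z (+-monoʳ-≤ x z≤y))) ,
  ≤-antisym z≤y (+-cancelˡ-≤ y y z (≤-trans 2y≤x+z (+-monoˡ-≤ z x≤y)))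

-- If `2 Y` is at most `X + Z`, maximality of `Y` forces equality. Otherwise `2 Y - (X + Z)` is a
-- positive multiple of `N` below `2 N`, hence `N` itself.
equal-or-wrapped : ∀ N {X Y Z} p q → Y + Y + N * p ≡ X + Z + N * q →
                   Y < N → X ≤ Y → Z ≤ Y → (X ≡ Y × Z ≡ Y) ⊎ Y + Y ≡ X + Z + N
equal-or-wrapped N {X} {Y} {Z} p q eq Y<N X≤Y Z≤Y with Y + Y ≤? X + Z
... | yes 2Y≤X+Z = inj₁ (≤-mid⇒≡ 2Y≤X+Z X≤Y Z≤Y)
... | no 2Y≰X+Z with wraps-at-most-once N q p (sym eq) (<-≤-trans (≰⇒> 2Y≰X+Z) (m≤m+n (Y + Y) N)) (+-mono-< Y<N Y<N)
...   | inj₁ X+Z≡2Y = contradiction (≤-reflexive (sym X+Z≡2Y)) 2Y≰X+Z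
...   | inj₂ X+Z+N≡2Y = inj₂ (sym X+Z+N≡2Y)

halve : ∀ b p → 2 * (b + p) ≡ b + b + 2 * p
halve b p = solve (b ∷ p ∷ [])

-- The left side is even, hence so is `a + c`, and two bits with an even sum agree.
same-parity : ∀ {a c} b p q → a < 2 → c < 2 → b + b + 2 * p ≡ a + c + 2 * q → a ≡ c
same-parity {zero} {zero} b p q _ _ eq = refl
same-parity {suc zero} {suc zero} b p q _ _ eq = refl
same-parity {zero} {suc zero} b p q _ _ eq =
  ⊥-elim (even≢odd (b + p) q (trans (halve b p) eq))
same-parity {suc zero} {zero} b p q _ _ eq =
  ⊥-elim (even≢odd (b + p) q (trans (halve b p) eq))
same-parity {suc (suc _)} b p q (s≤s (s≤s ())) _ eq
same-parity {_} {suc (suc _)} b p q _ (s≤s (s≤s ())) eq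

-- Midpoints within one row and across wrapped rows

-- Here x is a column and y a row.  In a late row the column is taken modulo
-- 12 m, so that x ranges over the left one of the two intervals.
module _ (m : ℕ) where

  Early : ℕ → ℕ → Set
  Early x y = (m * 3 ≤ x × x < m * 15) × (m * 8 ≤ x + y × x < m * 10 + y)

  Late : ℕ → ℕ → Set
  Late x y = x < m * 6 × y ≤ x + m * 10 × x + y < m * 16

  -- Reduction modulo half a period moves the quotients into the multipliers. There the parity of
  -- `a + c` survives, which tells whether `x` and `z` lie in the same half of the period.
  column-residues : ∀ {x y z x′ y′ z′} a b c p q →
    x ≡ x′ + a * (m * 12) → y ≡ y′ + b * (m * 12) → z ≡ z′ + c * (m * 12) →
    y + y + m * 24 * p ≡ x + z + m * 24 * q →
    y′ + y′ + m * 12 * (b + b + 2 * p) ≡ x′ + z′ + m * 12 * (a + c + 2 * q)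
  column-residues {x′ = x′} {y′} {z′} a b c p q refl refl refl eq =
    trans {j = y′ + b * (m * 12) + (y′ + b * (m * 12)) + m * 24 * p} (solve (m ∷ y′ ∷ b ∷ p ∷ []))
      (trans eq (solve (m ∷ x′ ∷ z′ ∷ a ∷ c ∷ q ∷ [])))

  -- The late bounds `Y - 10 m ≤ y < 16 m - Y` and the row equation put `2 y` in
  -- `[X + Z - 4 m, 16 m - X - Z)`, while the early bounds put `x + z` in
  -- `[16 m - X - Z, X + Z + 20 m)`. Both windows fit side by side into one period `24 m`, so they
  -- are disjoint modulo `24 m`.
  no-wrap-early-early : ∀ {x y z X Y Z} p q → Early x X → Late y Y → Early z Z → Y + Y ≡ X + Z + m * 16 →
    y + y + m * 24 * p ≡ x + z + m * 24 * q → ⊥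
  no-wrap-early-early {x} {y} {z} {X} {Y} {Z} p q
    ((_ , x<15m) , (8m≤x+X , x<10m+X)) (y<6m , Y≤y+10m , y+Y<16m) ((_ , z<15m) , (8m≤z+Z , z<10m+Z)) rows eq =
    [ unwrapped , wrapped ]′ (wraps-at-most-once (m * 24) p q eq 2y< x+z<)
    where
    2y< : y + y < x + z + m * 24
    2y< = sum-< {y + y} {x + z + m * 24} {k = 1 + x + z + m * 12} (y<6m ⊞ y<6m) (solve (m ∷ x ∷ y ∷ z ∷ []))
    x+z< : x + z < m * 24 + m * 24
    x+z< = sum-< {x + z} {m * 24 + m * 24} {k = 1 + m * 18} (x<15m ⊞ z<15m) (solve (m ∷ x ∷ z ∷ []))
    unwrapped : y + y ≡ x + z → ⊥
    unwrapped 2y≡x+z = sum-absurd {k = 1}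
      (≤-reflexive (sym 2y≡x+z) ⊞ ≤-reflexive (sym rows) ⊞ 8m≤x+X ⊞ 8m≤z+Z ⊞ y+Y<16m ⊞ y+Y<16m)
      (solve (m ∷ x ∷ X ∷ y ∷ Y ∷ z ∷ Z ∷ []))
    wrapped : y + y + m * 24 ≡ x + z → ⊥
    wrapped 2y+24m≡x+z = sum-absurd {k = 1}
      (≤-reflexive 2y+24m≡x+z ⊞ ≤-reflexive (sym rows) ⊞ x<10m+X ⊞ z<10m+Z ⊞ Y≤y+10m ⊞ Y≤y+10m)
      (solve (m ∷ x ∷ X ∷ y ∷ Y ∷ z ∷ Z ∷ []))

  -- The same comparison modulo `12 m`: as `X` is at least `8 m`, `2 y` lies in `[Z + 4 m, 8 m - Z)`
  -- and `x + z` in `[8 m - Z, Z + 16 m)`, which again fit into one period.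
  no-wrap-late-early : ∀ {x y z X Y Z} p q → Late x X → m * 8 ≤ X → Late y Y → Early z Z → Y + Y ≡ X + Z + m * 16 →
    y + y + m * 12 * p ≡ x + z + m * 12 * q → ⊥
  no-wrap-late-early {x} {y} {z} {X} {Y} {Z} p q
    (x<6m , _) 8m≤X (y<6m , Y≤y+10m , y+Y<16m) ((_ , z<15m) , (8m≤z+Z , z<10m+Z)) rows eq =
    [ unwrapped , wrapped ]′ (wraps-at-most-once (m * 12) p q eq 2y< x+z<)
    where
    2y< : y + y < x + z + m * 12
    2y< = sum-< {y + y} {x + z + m * 12} {k = 1 + x + z} (y<6m ⊞ y<6m) (solve (m ∷ x ∷ y ∷ z ∷ []))
    x+z< : x + z < m * 12 + m * 12
    x+z< = sum-< {x + z} {m * 12 + m * 12} {k = 1 + m * 3} (x<6m ⊞ z<15m) (solve (m ∷ x ∷ z ∷ []))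
    unwrapped : y + y ≡ x + z → ⊥
    unwrapped 2y≡x+z = sum-absurd {k = 1 + x}
      (≤-reflexive (sym 2y≡x+z) ⊞ ≤-reflexive (sym rows) ⊞ 8m≤X ⊞ 8m≤z+Z ⊞ y+Y<16m ⊞ y+Y<16m)
      (solve (m ∷ x ∷ X ∷ y ∷ Y ∷ z ∷ Z ∷ []))
    wrapped : y + y + m * 12 ≡ x + z → ⊥
    wrapped 2y+12m≡x+z = sum-absurd {k = 1}
      (≤-reflexive 2y+12m≡x+z ⊞ ≤-reflexive (sym rows) ⊞ x<6m ⊞ z<10m+Z ⊞ 8m≤X ⊞ Y≤y+10m ⊞ Y≤y+10m)
      (solve (m ∷ x ∷ X ∷ y ∷ Y ∷ z ∷ Z ∷ []))

  -- The row equation would give `2 Y ≥ 32 m`, putting `Y` above the top of the grid.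
  no-wrap-late-late : ∀ {y X Y Z} → m * 8 ≤ X → Late y Y → m * 8 ≤ Z → Y + Y ≡ X + Z + m * 16 → ⊥
  no-wrap-late-late {y} {X} {Y} {Z} 8m≤X (_ , _ , y+Y<16m) 8m≤Z rows = sum-absurd {k = 1 + y + y}
    (≤-reflexive (sym rows) ⊞ 8m≤X ⊞ 8m≤Z ⊞ y+Y<16m ⊞ y+Y<16m) (solve (m ∷ X ∷ y ∷ Y ∷ Z ∷ []))

  -- The columns lie in `[3 m, 15 m)`, half a period, so `2 y` and `x + z` differ by less than
  -- `24 m` and `y` is a true midpoint of `x` and `z`.
  early-row-order : ∀ {x y z Y} p q → Early x Y → Early y Y → Early z Y → x ≢ z →
    y + y + m * 24 * p ≡ x + z + m * 24 * q → y < x ⊎ y < z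
  early-row-order {x} {y} {z} p q ((3m≤x , x<15m) , _) ((3m≤y , y<15m) , _) ((3m≤z , z<15m) , _) x≢z eq
    with y <? x | y <? z
  ... | yes y<x | _ = inj₁ y<x
  ... | _ | yes y<z = inj₂ y<z
  ... | no y≮x | no y≮z = contradiction (trans (proj₁ mid) (sym (proj₂ mid))) x≢z
    where
    2y≡x+z : y + y ≡ x + z
    2y≡x+z = proj₁ (cancel-multiples {y + y} {x + z} (m * 24) p q eq
      (sum-< {y + y} {x + z + m * 24} {k = 1} (y<15m ⊞ y<15m ⊞ 3m≤x ⊞ 3m≤z) (solve (m ∷ x ∷ y ∷ z ∷ [])))
      (sum-< {x + z} {y + y + m * 24} {k = 1} (x<15m ⊞ z<15m ⊞ 3m≤y ⊞ 3m≤y) (solve (m ∷ x ∷ y ∷ z ∷ []))))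
    mid : x ≡ y × z ≡ y
    mid = ≤-mid⇒≡ (≤-reflexive 2y≡x+z) (≮⇒≥ y≮x) (≮⇒≥ y≮z)

  late-residues : ∀ {x y z Y} p q → Late x Y → Late y Y → Late z Y →
    y + y + m * 12 * p ≡ x + z + m * 12 * q → y + y ≡ x + z × p ≡ q
  late-residues {x} {y} {z} p q (x<6m , _) (y<6m , _) (z<6m , _) eq =
    cancel-multiples (m * 12) p q eq 2y< x+z<
    where
    2y< : y + y < x + z + m * 12
    2y< = sum-< {y + y} {x + z + m * 12} {k = 1 + x + z} (y<6m ⊞ y<6m) (solve (m ∷ x ∷ y ∷ z ∷ []))
    x+z< : x + z < y + y + m * 12
    x+z< = sum-< {x + z} {y + y + m * 12} {k = 1 + y + y} (x<6m ⊞ z<6m) (solve (m ∷ x ∷ y ∷ z ∷ []))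

  -- Equal residues do not yet give equal columns, because the two intervals of a late row share
  -- them. The last alternative keeps `p ≡ q` so that parity can decide.
  late-row-order : ∀ {x y z Y} p q → Late x Y → Late y Y → Late z Y →
    y + y + m * 12 * p ≡ x + z + m * 12 * q → y < x ⊎ y < z ⊎ (x ≡ z × p ≡ q)
  late-row-order {x} {y} {z} p q x∈ y∈ z∈ eq with y <? x | y <? z
  ... | yes y<x | _ = inj₁ y<x
  ... | _ | yes y<z = inj₂ (inj₁ y<z)
  ... | no y≮x | no y≮z = inj₂ (inj₂ (agree (late-residues p q x∈ y∈ z∈ eq)))
    where
    agree : y + y ≡ x + z × p ≡ q → x ≡ z × p ≡ q
    agree (2y≡x+z , p≡q) with ≤-mid⇒≡ (≤-reflexive 2y≡x+z) (≮⇒≥ y≮x) (≮⇒≥ y≮z)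
    ... | refl , refl = refl , p≡q

  -- Doubling turns a shift by half a period into a full period, so a late midpoint may be replaced
  -- by its residue while the modulus stays `24 m`.
  halve-late-columns : ∀ {y y′ w} b p → y ≡ y′ + b * (m * 12) →
    y + y + m * 24 * p ≡ w → y′ + y′ + m * 24 * (b + p) ≡ w
  halve-late-columns {y′ = y′} b p refl eq =
    trans {j = y′ + b * (m * 12) + (y′ + b * (m * 12)) + m * 24 * p} (solve (m ∷ y′ ∷ b ∷ p ∷ [])) eq

private instance
  12m≢0 : ∀ {m} .{{_ : NonZero m}} → NonZero (m * 12)
  12m≢0 {m} = m*n≢0 m 12

-- The region and its height function

module _ (m : ℕ) .{{_ : NonZero m}} where

  Region : ℕ → ℕ → Set
  Region x y = (y < m * 8 × Early m x y) ⊎ (m * 8 ≤ y × Late m (x % (m * 12)) y)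

  region? : ∀ x y → Dec (Region x y)
  region? x y =
    (y <? m * 8 ×-dec
      ((m * 3 ≤? x ×-dec x <? m * 15) ×-dec (m * 8 ≤? x + y ×-dec x <? m * 10 + y)))
    ⊎-dec
    (m * 8 ≤? y ×-dec
      (x % (m * 12) <? m * 6 ×-dec (y ≤? x % (m * 12) + m * 10 ×-dec x % (m * 12) + y <? m * 16)))

  early : ∀ {x y} → y < m * 8 → Region x y → Early m x y
  early _ (inj₁ (_ , e)) = e
  early y<8m (inj₂ (8m≤y , _)) = contradiction 8m≤y (<⇒≱ y<8m)

  late : ∀ {x y} → m * 8 ≤ y → Region x y → Late m (x % (m * 12)) y
  late 8m≤y (inj₁ (y<8m , _)) = contradiction 8m≤y (<⇒≱ y<8m)
  late _ (inj₂ (_ , l)) = l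

  local : ℕ → ℕ → ℕ
  local x y with y <? m * 8
  ... | yes _ = x
  ... | no _ = x % (m * 12)

  local≤ : ∀ x y → local x y ≤ x
  local≤ x y with y <? m * 8
  ... | yes _ = ≤-refl
  ... | no _ = m%n≤m x (m * 12)

  -- The lexicographic order, row first, written as a number in base `24 m`. In the upper rows,
  -- points half a period apart have the same height.
  height : ℕ → ℕ → ℕ
  height x y = y * (m * 24) + local x y

  lower-row : ∀ {x y X Y} → y < m * 24 → Y < X → height y Y < height x X
  lower-row {x} {y} {X} {Y} y<24m Y<X = begin-strict
    Y * (m * 24) + local y Y <⟨ +-monoʳ-< (Y * (m * 24)) (≤-<-trans (local≤ y Y) y<24m) ⟩
    Y * (m * 24) + m * 24    ≡⟨ +-comm (Y * (m * 24)) (m * 24) ⟩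
    suc Y * (m * 24)         ≤⟨ *-monoˡ-≤ (m * 24) Y<X ⟩
    X * (m * 24)             ≤⟨ m≤m+n (X * (m * 24)) (local x X) ⟩
    X * (m * 24) + local x X ∎
    where open ≤-Reasoning

  split : ∀ x → x ≡ x % (m * 12) + x / (m * 12) * (m * 12)
  split x = m≡m%n+[m/n]*n x (m * 12)

  half<2 : ∀ {x} → x < m * 24 → x / (m * 12) < 2
  half<2 x<24m = m<n*o⇒m/o<n {n = 2} {o = m * 12} (<-≤-trans x<24m (≤-reflexive (24m≡2*12m m)))
    where
    24m≡2*12m : ∀ m → m * 24 ≡ 2 * (m * 12)
    24m≡2*12m m = solve (m ∷ [])

  same-row-order : ∀ {x y z Y} p q → x < m * 24 → z < m * 24 →
    Region x Y → Region y Y → Region z Y → x ≢ z →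
    y + y + m * 24 * p ≡ x + z + m * 24 * q → local y Y < local x Y ⊎ local y Y < local z Y
  same-row-order {x} {y} {z} {Y} p q x<24m z<24m x∈ y∈ z∈ x≢z eq with Y <? m * 8
  ... | yes Y<8m = early-row-order m p q (early Y<8m x∈) (early Y<8m y∈) (early Y<8m z∈) x≢z eq
  ... | no Y≮8m = Sum.map₂ [ id , (λ (x′≡z′ , parity) → contradiction (x≡z x′≡z′ parity) x≢z) ]′
    (late-row-order m (b + b + 2 * p) (a + c + 2 * q)
      (late (≮⇒≥ Y≮8m) x∈) (late (≮⇒≥ Y≮8m) y∈) (late (≮⇒≥ Y≮8m) z∈)
      (column-residues m a b c p q (split x) (split y) (split z) eq))
    where
    a = x / (m * 12)
    b = y / (m * 12)
    c = z / (m * 12)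
    -- The quotients of `x` and `z` are 0 or 1, so their parities determine them, and the columns
    -- agree.
    x≡z : x % (m * 12) ≡ z % (m * 12) → b + b + 2 * p ≡ a + c + 2 * q → x ≡ z
    x≡z x′≡z′ parity = trans (split x) (trans
      (cong₂ (λ r k → r + k * (m * 12)) x′≡z′ (same-parity b p q (half<2 x<24m) (half<2 z<24m) parity))
      (sym (split z)))

  no-wrap-mixed : ∀ {x y z X Y Z} p q →
    m * 8 ≤ X × Late m (x % (m * 12)) X → Late m (y % (m * 12)) Y → Early m z Z → Y + Y ≡ X + Z + m * 16 →
    y + y + m * 24 * p ≡ x + z + m * 24 * q → ⊥
  no-wrap-mixed {x} {y} {z} p q (8m≤X , x∈) y∈ z∈ rows eq =
    -- The early column `z` is left unreduced, hence its quotient 0.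
    no-wrap-late-early m (b + b + 2 * p) (a + 0 + 2 * q) x∈ 8m≤X y∈ z∈ rows
      (column-residues m a b 0 p q (split x) (split y) (sym (+-identityʳ z)) eq)
    where
    a = x / (m * 12)
    b = y / (m * 12)

  wrapped-row-late : ∀ {X Y Z} → Y + Y ≡ X + Z + m * 16 → m * 8 ≤ Y
  wrapped-row-late {X} {Y} {Z} rows = ≮⇒≥ λ (Y<8m : Y < m * 8) → sum-absurd {k = 1 + X + Z}
    (≤-reflexive (sym rows) ⊞ Y<8m ⊞ Y<8m) (solve (m ∷ X ∷ Y ∷ Z ∷ []))

  no-wrap-unmixed : ∀ {x y z X Y Z} p q →
    Early m x X → Late m (y % (m * 12)) Y → Early m z Z → Y + Y ≡ X + Z + m * 16 →
    y + y + m * 24 * p ≡ x + z + m * 24 * q → ⊥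
  no-wrap-unmixed {x} {y} {z} {X} {Y} {Z} p q x∈ y∈ z∈ rows eq =
    no-wrap-early-early m {x} {y % (m * 12)} {z} {X} {Y} {Z} (y / (m * 12) + p) q x∈ y∈ z∈ rows
      (halve-late-columns m (y / (m * 12)) p (split y) eq)

  no-wrap : ∀ {x y z X Y Z} p q → Region x X → Region y Y → Region z Z → Y + Y ≡ X + Z + m * 16 →
    y + y + m * 24 * p ≡ x + z + m * 24 * q → ⊥
  no-wrap {X = X} {Y} {Z} p q x∈ (inj₁ (Y<8m , _)) z∈ rows _ = <⇒≱ Y<8m (wrapped-row-late {X} {Y} {Z} rows)
  no-wrap {x} {y} {z} {X} {Y} {Z} p q (inj₁ (_ , x∈)) (inj₂ (_ , y∈)) (inj₁ (_ , z∈)) rows eq =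
    no-wrap-unmixed {x} {y} {z} {X} {Y} {Z} p q x∈ y∈ z∈ rows eq
  no-wrap {x} {y} {z} {X} {Y} {Z} p q (inj₂ x∈) (inj₂ (_ , y∈)) (inj₁ (_ , z∈)) rows eq =
    no-wrap-mixed {x} {y} {z} {X} {Y} {Z} p q x∈ y∈ z∈ rows eq
  no-wrap {x} {y} {z} {X} {Y} {Z} p q (inj₁ (_ , x∈)) (inj₂ (_ , y∈)) (inj₂ z∈) rows eq =
    no-wrap-mixed {z} {y} {x} {Z} {Y} {X} p q z∈ y∈ x∈
      (trans rows (cong (_+ m * 16) (+-comm X Z))) (trans eq (cong (_+ m * 24 * q) (+-comm x z)))
  no-wrap {x} {y} {z} {X} {Y} {Z} p q (inj₂ (8m≤X , _)) (inj₂ (_ , y∈)) (inj₂ (8m≤Z , _)) rows eq =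
    no-wrap-late-late m {y % (m * 12)} {X} {Y} {Z} 8m≤X y∈ 8m≤Z rows

  -- If neither `X` nor `Z` exceeds `Y`, `equal-or-wrapped` leaves either one common row, where the
  -- columns decide, or a wrapped row equation, which `no-wrap` excludes.
  midpoint-below : ∀ {x y z X Y Z} p q p′ q′ →
    x < m * 24 → y < m * 24 → z < m * 24 → Y < m * 16 →
    Region x X → Region y Y → Region z Z → ¬ (x ≡ z × X ≡ Z) →
    y + y + m * 24 * p ≡ x + z + m * 24 * q → Y + Y + m * 16 * p′ ≡ X + Z + m * 16 * q′ →
    height y Y < height x X ⊎ height y Y < height z Z
  midpoint-below {x} {y} {z} {X} {Y} {Z} p q p′ q′ x<24m y<24m z<24m Y<16m x∈ y∈ z∈ x≢z columns rows
    with Y <? X | Y <? Z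
  ... | yes Y<X | _ = inj₁ (lower-row {x} y<24m Y<X)
  ... | _ | yes Y<Z = inj₂ (lower-row {z} y<24m Y<Z)
  ... | no Y≮X | no Y≮Z =
    [ same-row , (λ wrapped → ⊥-elim (no-wrap p q x∈ y∈ z∈ wrapped columns)) ]′
      (equal-or-wrapped (m * 16) p′ q′ rows Y<16m (≮⇒≥ Y≮X) (≮⇒≥ Y≮Z))
    where
    same-row : X ≡ Y × Z ≡ Y → height y Y < height x X ⊎ height y Y < height z Z
    same-row (refl , refl) = Sum.map (+-monoʳ-< (Y * (m * 24))) (+-monoʳ-< (Y * (m * 24)))
      (same-row-order p q x<24m z<24m x∈ y∈ z∈ (λ x≡z → x≢z (x≡z , refl)) columns)

-- Finite sums and counting

Σ< : ℕ → (ℕ → ℕ) → ℕ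
Σ< zero    f = 0
Σ< (suc n) f = f 0 + Σ< n (f ∘ suc)

Σ-cong : ∀ n {f g : ℕ → ℕ} → (∀ k → f k ≡ g k) → Σ< n f ≡ Σ< n g
Σ-cong zero    f≗g = refl
Σ-cong (suc n) f≗g = cong₂ _+_ (f≗g 0) (Σ-cong n (f≗g ∘ suc))

Σ-mono : ∀ n {f g : ℕ → ℕ} → (∀ k → k < n → f k ≤ g k) → Σ< n f ≤ Σ< n g
Σ-mono zero    f≤g = z≤n
Σ-mono (suc n) f≤g = +-mono-≤ (f≤g 0 z<s) (Σ-mono n λ k k<n → f≤g (suc k) (s<s k<n))

Σ-const : ∀ n c → Σ< n (λ _ → c) ≡ n * c
Σ-const zero    c = refl
Σ-const (suc n) c = cong (c +_) (Σ-const n c)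

+-interchange : ∀ a b c d → (a + b) + (c + d) ≡ (a + c) + (b + d)
+-interchange a b c d = solve (a ∷ b ∷ c ∷ d ∷ [])

Σ-distrib-+ : ∀ n (f g : ℕ → ℕ) → Σ< n (λ k → f k + g k) ≡ Σ< n f + Σ< n g
Σ-distrib-+ zero    f g = refl
Σ-distrib-+ (suc n) f g = trans (cong (f 0 + g 0 +_) (Σ-distrib-+ n (f ∘ suc) (g ∘ suc)))
  (+-interchange (f 0) (g 0) (Σ< n (f ∘ suc)) (Σ< n (g ∘ suc)))

Σ-swap : ∀ n k (f : ℕ → ℕ → ℕ) → Σ< n (λ i → Σ< k (f i)) ≡ Σ< k (λ j → Σ< n (λ i → f i j))
Σ-swap zero    k f = sym (trans (Σ-const k 0) (*-zeroʳ k))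
Σ-swap (suc n) k f = trans (cong (Σ< k (f 0) +_) (Σ-swap n k (f ∘ suc)))
  (sym (Σ-distrib-+ k (f 0) (λ j → Σ< n (λ i → f (suc i) j))))

Σ-split : ∀ a b (f : ℕ → ℕ) → Σ< (a + b) f ≡ Σ< a f + Σ< b (λ k → f (a + k))
Σ-split zero    b f = refl
Σ-split (suc a) b f = trans (cong (f 0 +_) (Σ-split a b (f ∘ suc)))
  (sym (+-assoc (f 0) (Σ< a (f ∘ suc)) (Σ< b (λ k → f (suc a + k)))))

-- Division with remainder by `k` reorders the sum. The induction peels off the block `a = 0` and
-- shifts `f` by `k`.
Σ-residues : ∀ k m (f : ℕ → ℕ) → Σ< k (λ i → Σ< m (λ a → f (i + a * k))) ≡ Σ< (m * k) f
Σ-residues k zero    f = trans (Σ-const k 0) (*-zeroʳ k)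
Σ-residues k (suc m) f = begin
  Σ< k (λ i → f (i + 0) + Σ< m (λ a → f (i + (k + a * k))))
    ≡⟨ Σ-distrib-+ k (λ i → f (i + 0)) (λ i → Σ< m (λ a → f (i + (k + a * k)))) ⟩
  Σ< k (λ i → f (i + 0)) + Σ< k (λ i → Σ< m (λ a → f (i + (k + a * k))))
    ≡⟨ cong₂ _+_ (Σ-cong k λ i → cong f (+-identityʳ i))
         (Σ-cong k λ i → Σ-cong m λ a → cong f (+-assoc-comm i k (a * k))) ⟩
  Σ< k f + Σ< k (λ i → Σ< m (λ a → f (k + (i + a * k))))
    ≡⟨ cong (Σ< k f +_) (Σ-residues k m (λ x → f (k + x))) ⟩
  Σ< k f + Σ< (m * k) (λ x → f (k + x))
    ≡⟨ Σ-split k (m * k) f ⟨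
  Σ< (k + m * k) f ∎
  where
  open ≡-Reasoning
  +-assoc-comm : ∀ a b c → a + (b + c) ≡ b + (a + c)
  +-assoc-comm a b c = solve (a ∷ b ∷ c ∷ [])

Σ-≤-max : ∀ n (f : ℕ → ℕ) → ∃ λ i → i < suc n × Σ< (suc n) f ≤ suc n * f i
Σ-≤-max zero    f = 0 , z<s , ≤-refl
Σ-≤-max (suc n) f with Σ-≤-max n (f ∘ suc)
... | i , i<1+n , Σ≤ with ≤-total (f 0) (f (suc i))
...   | inj₁ f0≤ = suc i , s<s i<1+n , +-mono-≤ f0≤ Σ≤
...   | inj₂ f0≥ = 0 , z<s , +-monoʳ-≤ (f 0) (≤-trans Σ≤ (*-monoʳ-≤ (suc n) f0≥))

Σ-≤-max₂ : ∀ n k (f : ℕ → ℕ → ℕ) → ∃₂ λ i j → i < suc n × j < suc k ×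
  Σ< (suc n) (λ i → Σ< (suc k) (f i)) ≤ suc n * (suc k * f i j)
Σ-≤-max₂ n k f with Σ-≤-max n (λ i → Σ< (suc k) (f i))
... | i , i<1+n , outer with Σ-≤-max k (f i)
...   | j , j<1+k , inner = i , j , i<1+n , j<1+k , ≤-trans outer (*-monoʳ-≤ (suc n) inner)

-- An arithmetic progression; the summand `n` on the left avoids the subtraction in
-- `n * (2 c + n - 1)`.
Σ-ascending : ∀ n c → Σ< n (λ k → (c + k) * 2) + n ≡ n * (c * 2 + n)
Σ-ascending zero    c = refl
Σ-ascending (suc n) c = begin
  (c + 0) * 2 + Σ< n (λ k → (c + suc k) * 2) + suc n
    ≡⟨ cong (λ s → (c + 0) * 2 + s + suc n) (Σ-cong n λ k → cong (_* 2) (+-suc c k)) ⟩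
  (c + 0) * 2 + Σ< n (λ k → (suc c + k) * 2) + suc n
    ≡⟨ regroup c n (Σ< n (λ k → (suc c + k) * 2)) ⟩
  c * 2 + 1 + (Σ< n (λ k → (suc c + k) * 2) + n)
    ≡⟨ cong (c * 2 + 1 +_) (Σ-ascending n (suc c)) ⟩
  c * 2 + 1 + n * (suc c * 2 + n)
    ≡⟨ square c n ⟩
  suc n * (c * 2 + suc n) ∎
  where
  open ≡-Reasoning
  regroup : ∀ c n s → (c + 0) * 2 + s + suc n ≡ c * 2 + 1 + (s + n)
  regroup c n s = solve (c ∷ n ∷ s ∷ [])
  square : ∀ c n → c * 2 + 1 + n * (suc c * 2 + n) ≡ suc n * (c * 2 + suc n)
  square c n = solve (c ∷ n ∷ [])

Σ-descending : ∀ n → Σ< n (λ k → (n ∸ k) * 4) ≡ n * (n * 2 + 2)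
Σ-descending zero    = refl
Σ-descending (suc n) = trans (cong (suc n * 4 +_) (Σ-descending n)) (square n)
  where
  square : ∀ n → suc n * 4 + n * (n * 2 + 2) ≡ suc n * (suc n * 2 + 2)
  square n = solve (n ∷ [])

⟦_⟧ : ∀ {p} {P : Set p} → Dec P → ℕ
⟦ P? ⟧ = if does P? then 1 else 0

⟦⟧-yes : ∀ {p} {P : Set p} (P? : Dec P) → P → ⟦ P? ⟧ ≡ 1
⟦⟧-yes (yes _) _ = refl
⟦⟧-yes (no ¬p) p = contradiction p ¬p

interval-count : ∀ {p} {P : Pred ℕ p} (P? : Decidable P) lo w n → lo + w ≤ n →
  (∀ k → k < w → P (lo + k)) → w ≤ Σ< n (λ x → ⟦ P? x ⟧)
interval-count P? zero zero n _ _ = z≤n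
interval-count P? zero (suc w) (suc n) (s≤s w≤n) P[] =
  +-mono-≤ (≤-reflexive (sym (⟦⟧-yes (P? 0) (P[] 0 z<s))))
    (interval-count (P? ∘ suc) zero w n w≤n λ k k<w → P[] (suc k) (s<s k<w))
interval-count P? (suc lo) w (suc n) (s≤s lo+w≤n) P[] =
  ≤-trans (interval-count (P? ∘ suc) lo w n lo+w≤n P[]) (m≤n+m _ ⟦ P? 0 ⟧)

module _ {a p} {A : Set a} {P : Pred A p} (P? : Decidable P) where

  length-filter-∷ : ∀ x xs → length (filter P? (x ∷ xs)) ≡ ⟦ P? x ⟧ + length (filter P? xs)
  length-filter-∷ x xs with P? x
  ... | yes _ = refl
  ... | no _ = refl

  length-filter-tabulate : ∀ {n} (f : Fin n → A) (g : ℕ → ℕ) → (∀ i → ⟦ P? (f i) ⟧ ≡ g (toℕ i)) →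
    length (filter P? (tabulate f)) ≡ Σ< n g
  length-filter-tabulate {zero}  f g f≗g = refl
  length-filter-tabulate {suc n} f g f≗g = trans (length-filter-∷ (f zero) (tabulate (f ∘ suc)))
    (cong₂ _+_ (f≗g zero) (length-filter-tabulate (f ∘ suc) (g ∘ suc) (f≗g ∘ suc)))

  length-filter-product : ∀ {b c} {B : Set b} {C : Set c} {k n} (_∙_ : B → C → A)
    (u : Fin k → B) (v : Fin n → C) (g : ℕ → ℕ → ℕ) → (∀ i j → ⟦ P? (u i ∙ v j) ⟧ ≡ g (toℕ i) (toℕ j)) →
    length (filter P? (cartesianProductWith _∙_ (tabulate u) (tabulate v))) ≡ Σ< k (λ i → Σ< n (g i))
  length-filter-product {k = zero}  _∙_ u v g h = refl
  length-filter-product {k = suc k} {n} _∙_ u v g h = begin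
    length (filter P? (map (u zero ∙_) (tabulate v) ++ rest))
      ≡⟨ cong length (filter-++ P? (map (u zero ∙_) (tabulate v)) rest) ⟩
    length (filter P? (map (u zero ∙_) (tabulate v)) ++ filter P? rest)
      ≡⟨ length-++ (filter P? (map (u zero ∙_) (tabulate v))) ⟩
    length (filter P? (map (u zero ∙_) (tabulate v))) + length (filter P? rest)
      ≡⟨ cong₂ _+_
           (trans (cong (λ xs → length (filter P? xs)) (map-tabulate v (u zero ∙_)))
             (length-filter-tabulate (λ j → u zero ∙ v j) (g 0) (h zero)))
           (length-filter-product _∙_ (u ∘ suc) v (g ∘ suc) (h ∘ suc)) ⟩
    Σ< n (g 0) + Σ< k (λ i → Σ< n (g (suc i))) ∎
    where
    open ≡-Reasoning
    rest = cartesianProductWith _∙_ (tabulate (u ∘ suc)) (tabulate v)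

-- The size of the region

module _ (m : ℕ) .{{_ : NonZero m}} where

  row : ℕ → ℕ
  row y = Σ< (m * 24) (λ x → ⟦ region? m x y ⟧)

  widening-row : ∀ y → y < m * 5 → (m + y) * 2 ≤ row y
  widening-row y y<5m = from-left-end (m * 8 ∸ y) (m∸n+n≡m (<⇒≤ y<8m))
    where
    y<8m : y < m * 8
    y<8m = sum-< {y} {m * 8} {k = m * 3} y<5m (solve (m ∷ y ∷ []))
    -- The left end `8 m - y` is made a variable with a defining equation, so that the ring solver
    -- meets no truncated subtraction.
    from-left-end : ∀ lo → lo + y ≡ m * 8 → (m + y) * 2 ≤ row y
    from-left-end lo lo+y≡8m = interval-count (λ x → region? m x y) lo ((m + y) * 2) (m * 24)
      (sum-≤ {lo + (m + y) * 2} {m * 24} {k = 1 + m * 9} (≤-reflexive lo+y≡8m ⊞ y<5m) (solve (m ∷ lo ∷ y ∷ [])))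
      λ k k<w → inj₁ (y<8m ,
        ( sum-≤ {m * 3} {lo + k} {k = 1 + k} (≤-reflexive (sym lo+y≡8m) ⊞ y<5m) (solve (m ∷ lo ∷ k ∷ y ∷ []))
        , sum-< {lo + k} {m * 15} {k = 1} (≤-reflexive lo+y≡8m ⊞ y<5m ⊞ k<w) (solve (m ∷ lo ∷ k ∷ y ∷ []))) ,
        ( sum-≤ {m * 8} {lo + k + y} {k = k} (≤-reflexive (sym lo+y≡8m)) (solve (m ∷ lo ∷ k ∷ y ∷ []))
        , sum-< {lo + k} {m * 10 + y} {k = 0} (≤-reflexive lo+y≡8m ⊞ k<w) (solve (m ∷ lo ∷ k ∷ y ∷ []))))

  half-row : ∀ h → h < m * 3 → m * 12 ≤ row (m * 5 + h)
  half-row h h<3m = interval-count (λ x → region? m x (m * 5 + h)) (m * 3) (m * 12) (m * 24)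
    (sum-≤ {m * 3 + m * 12} {m * 24} {k = m * 9} (≤-refl {0}) (solve (m ∷ [])))
    λ k k<12m → inj₁ (
      sum-< {m * 5 + h} {m * 8} {k = 0} h<3m (solve (m ∷ h ∷ [])) ,
      (m≤m+n (m * 3) k , sum-< {m * 3 + k} {m * 15} {k = 0} k<12m (solve (m ∷ k ∷ []))) ,
      ( sum-≤ {m * 8} {m * 3 + k + (m * 5 + h)} {k = k + h} (≤-refl {0}) (solve (m ∷ k ∷ h ∷ []))
      , sum-< {m * 3 + k} {m * 10 + (m * 5 + h)} {k = h} k<12m (solve (m ∷ k ∷ h ∷ []))))

  -- The interval is counted once in each half of the period, since `x` and `12 m + x` have the same
  -- residue.
  late-row : ∀ y lo w → m * 8 ≤ y → lo + w ≤ m * 12 → (∀ k → k < w → Late m (lo + k) y) → w + w ≤ row y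
  late-row y lo w 8m≤y lo+w≤12m inside = ≤-trans
    (+-mono-≤
      (interval-count (λ x → region? m x y) lo w (m * 12) lo+w≤12m λ k k<w →
        inj₂ (8m≤y , subst (λ x → Late m x y) (sym (residue k k<w)) (inside k k<w)))
      (interval-count (λ x → region? m (m * 12 + x) y) lo w (m * 12) lo+w≤12m λ k k<w →
        inj₂ (8m≤y , subst (λ x → Late m x y) (sym (residue′ k k<w)) (inside k k<w))))
    (≤-reflexive (trans (sym (Σ-split (m * 12) (m * 12) f)) (cong (λ n → Σ< n f) 12m+12m≡24m)))
    where
    f = λ x → ⟦ region? m x y ⟧
    12m+12m≡24m : m * 12 + m * 12 ≡ m * 24
    12m+12m≡24m = solve (m ∷ [])
    residue : ∀ k → k < w → (lo + k) % (m * 12) ≡ lo + k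
    residue k k<w = m<n⇒m%n≡m (<-≤-trans (+-monoʳ-< lo k<w) lo+w≤12m)
    residue′ : ∀ k → k < w → (m * 12 + (lo + k)) % (m * 12) ≡ lo + k
    residue′ k k<w = trans (cong (_% (m * 12)) (+-comm (m * 12) (lo + k)))
      (trans ([m+n]%n≡m%n (lo + k) (m * 12)) (residue k k<w))

  -- The row index is nested as iterated `Σ-split` produces it in `region-size`.
  doubled-row : ∀ h → h < m * 2 → m * 6 + m * 6 ≤ row (m * 5 + (m * 3 + h))
  doubled-row h h<2m = late-row (m * 5 + (m * 3 + h)) 0 (m * 6)
    (sum-≤ {m * 8} {m * 5 + (m * 3 + h)} {k = h} (≤-refl {0}) (solve (m ∷ h ∷ [])))
    (sum-≤ {m * 6} {m * 12} {k = m * 6} (≤-refl {0}) (solve (m ∷ [])))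
    λ k k<6m → k<6m ,
      sum-≤ {m * 5 + (m * 3 + h)} {k + m * 10} {k = 1 + k} h<2m (solve (m ∷ k ∷ h ∷ [])) ,
      sum-< {k + (m * 5 + (m * 3 + h))} {m * 16} {k = 1} (k<6m ⊞ h<2m) (solve (m ∷ k ∷ h ∷ []))

  -- In row `10 m + h` the left interval is `[h, 6 m - h)`.
  narrowing-row : ∀ h → h < m * 3 → (m * 3 ∸ h) * 4 ≤ row (m * 5 + (m * 3 + (m * 2 + h)))
  narrowing-row h h<3m = from-width (m * 3 ∸ h) (m∸n+n≡m (<⇒≤ h<3m))
    where
    double : ∀ r → r * 4 ≡ r * 2 + r * 2
    double r = solve (r ∷ [])
    from-width : ∀ r → r + h ≡ m * 3 → r * 4 ≤ row (m * 5 + (m * 3 + (m * 2 + h)))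
    from-width r r+h≡3m = ≤-trans (≤-reflexive (double r)) (late-row (m * 5 + (m * 3 + (m * 2 + h))) h (r * 2)
      (sum-≤ {m * 8} {m * 5 + (m * 3 + (m * 2 + h))} {k = m * 2 + h} (≤-refl {0}) (solve (m ∷ h ∷ [])))
      (sum-≤ {h + r * 2} {m * 12} {k = m * 6 + h} 2r+2h≤6m (solve (m ∷ h ∷ r ∷ [])))
      λ k k<2r →
        sum-< {h + k} {m * 6} {k = h} (2r+2h≤6m ⊞ k<2r) (solve (m ∷ h ∷ k ∷ r ∷ [])) ,
        sum-≤ {m * 5 + (m * 3 + (m * 2 + h))} {h + k + m * 10} {k = k} (≤-refl {0}) (solve (m ∷ h ∷ k ∷ [])) ,
        sum-< {h + k + (m * 5 + (m * 3 + (m * 2 + h)))} {m * 16} {k = 0} (2r+2h≤6m ⊞ k<2r) (solve (m ∷ h ∷ k ∷ r ∷ [])))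
      where
      2r+2h≤6m : r + h + (r + h) ≤ m * 3 + m * 3
      2r+2h≤6m = ≤-reflexive r+h≡3m ⊞ ≤-reflexive r+h≡3m

  -- The rows below `5 m`, `8 m`, `10 m` and `13 m` contribute in turn at least `35 m² - 5 m`,
  -- `36 m²`, `24 m²` and `18 m² + 6 m`, together `113 m² + m`.
  region-size : m * m * 112 ≤ Σ< (m * 16) row
  -- The slack `k` is the surplus `m² + m` over the claim, plus the rows from `13 m` on, bounded
  -- below by 0.
  region-size = sum-≤ {m * m * 112} {Σ< (m * 16) row} {k = s₅ + m * m + m}
    (≤-reflexive (sym rows) ⊞ Σ-mono (m * 5) widening-row
      ⊞ Σ-mono (m * 3) half-row ⊞ Σ-mono (m * 2) doubled-row ⊞ Σ-mono (m * 3) narrowing-row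
      ⊞ ≤-reflexive (sym (Σ-ascending (m * 5) m)) ⊞ ≤-reflexive (sym (Σ-const (m * 3) (m * 12)))
      ⊞ ≤-reflexive (sym (Σ-const (m * 2) (m * 6 + m * 6))) ⊞ ≤-reflexive (sym (Σ-descending (m * 3))))
    (balance m (Σ< (m * 16) row) s₁ s₂ s₃ s₄ s₅ (Σ< (m * 5) (λ k → (m + k) * 2)) (Σ< (m * 3) (λ _ → m * 12))
      (Σ< (m * 2) (λ _ → m * 6 + m * 6)) (Σ< (m * 3) (λ k → (m * 3 ∸ k) * 4)))
    where
    row₂ = λ k → row (m * 5 + k)
    row₃ = λ k → row₂ (m * 3 + k)
    row₄ = λ k → row₃ (m * 2 + k)
    row₅ = λ k → row₄ (m * 3 + k)
    s₁ = Σ< (m * 5) row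
    s₂ = Σ< (m * 3) row₂
    s₃ = Σ< (m * 2) row₃
    s₄ = Σ< (m * 3) row₄
    s₅ = Σ< (m * 3) row₅
    16m≡ : m * 16 ≡ m * 5 + (m * 3 + (m * 2 + (m * 3 + m * 3)))
    16m≡ = solve (m ∷ [])
    rows : Σ< (m * 16) row ≡ s₁ + (s₂ + (s₃ + (s₄ + s₅)))
    rows = begin
      Σ< (m * 16) row
        ≡⟨ cong (λ n → Σ< n row) 16m≡ ⟩
      Σ< (m * 5 + (m * 3 + (m * 2 + (m * 3 + m * 3)))) row
        ≡⟨ Σ-split (m * 5) (m * 3 + (m * 2 + (m * 3 + m * 3))) row ⟩
      s₁ + Σ< (m * 3 + (m * 2 + (m * 3 + m * 3))) row₂
        ≡⟨ cong (s₁ +_) (Σ-split (m * 3) (m * 2 + (m * 3 + m * 3)) row₂) ⟩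
      s₁ + (s₂ + Σ< (m * 2 + (m * 3 + m * 3)) row₃)
        ≡⟨ cong (λ s → s₁ + (s₂ + s)) (Σ-split (m * 2) (m * 3 + m * 3) row₃) ⟩
      s₁ + (s₂ + (s₃ + Σ< (m * 3 + m * 3) row₄))
        ≡⟨ cong (λ s → s₁ + (s₂ + (s₃ + s))) (Σ-split (m * 3) (m * 3) row₄) ⟩
      s₁ + (s₂ + (s₃ + (s₄ + s₅))) ∎
      where open ≡-Reasoning
    balance : ∀ m s s₁ s₂ s₃ s₄ s₅ t₁ t₂ t₃ t₄ →
      s₁ + (s₂ + (s₃ + (s₄ + s₅))) + t₁ + t₂ + t₃ + t₄ + m * 5 * (m * 2 + m * 5) + m * 3 * (m * 12)
        + m * 2 * (m * 6 + m * 6) + m * 3 * (m * 3 * 2 + 2) + suc s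
      ≡ suc (s₅ + m * m + m) + (s + s₁ + s₂ + s₃ + s₄ + (t₁ + m * 5) + t₂ + t₃ + t₄ + m * m * 112)
    balance m s s₁ s₂ s₃ s₄ s₅ t₁ t₂ t₃ t₄ =
      solve (m ∷ s ∷ s₁ ∷ s₂ ∷ s₃ ∷ s₄ ∷ s₅ ∷ t₁ ∷ t₂ ∷ t₃ ∷ t₄ ∷ [])

-- Sections of the region by translates of ℤ_m²

-- Each side receives the quotient of the other, which expresses the congruence without subtraction.
%-equal⇒multiples : ∀ m .{{_ : NonZero m}} s t → s % m ≡ t % m → s + m * (t / m) ≡ t + m * (s / m)
%-equal⇒multiples m s t s%m≡t%m = begin
  s + m * (t / m)                       ≡⟨ cong (_+ m * (t / m)) (m≡m%n+[m/n]*n s m) ⟩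
  s % m + s / m * m + m * (t / m)       ≡⟨ cong (λ r → r + s / m * m + m * (t / m)) s%m≡t%m ⟩
  t % m + s / m * m + m * (t / m)       ≡⟨ exchange (t % m) (s / m) (t / m) ⟩
  t % m + t / m * m + m * (s / m)       ≡⟨ cong (_+ m * (s / m)) (m≡m%n+[m/n]*n t m) ⟨
  t + m * (s / m)                       ∎
  where
  open ≡-Reasoning
  exchange : ∀ r u v → r + u * m + m * v ≡ r + v * m + m * u
  exchange r u v = solve (r ∷ u ∷ v ∷ m ∷ [])

-- The affine map sending `A` to `i + A * k` respects midpoint equations because the offset enters
-- both sides twice; the modulus grows by the factor `k`.
rescale : ∀ m k i A B C p q → A + A + m * p ≡ B + C + m * q →
  (i + A * k) + (i + A * k) + m * k * p ≡ (i + B * k) + (i + C * k) + m * k * q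
rescale m k i A B C p q eq = begin
  (i + A * k) + (i + A * k) + m * k * p ≡⟨ collect A A p ⟩
  (A + A + m * p) * k + (i + i)         ≡⟨ cong (λ s → s * k + (i + i)) eq ⟩
  (B + C + m * q) * k + (i + i)         ≡⟨ collect B C q ⟨
  (i + B * k) + (i + C * k) + m * k * q ∎
  where
  open ≡-Reasoning
  collect : ∀ B C q → (i + B * k) + (i + C * k) + m * k * q ≡ (B + C + m * q) * k + (i + i)
  collect B C q = solve (m ∷ k ∷ i ∷ B ∷ C ∷ q ∷ [])

module _ {m : ℕ} .{{_ : NonZero m}} where

  +ₘ-rescale : ∀ k i (a b c : ℤ/ m) → b +ₘ b ≡ a +ₘ c → ∃₂ λ p q →
    (i + toℕ b * k) + (i + toℕ b * k) + m * k * p ≡ (i + toℕ a * k) + (i + toℕ c * k) + m * k * q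
  +ₘ-rescale k i a b c eq = t / m , s / m ,
    rescale m k i (toℕ b) (toℕ a) (toℕ c) (t / m) (s / m) (%-equal⇒multiples m s t
      (trans (sym (toℕ-fromℕ< (m%n<n s m))) (trans (cong toℕ eq) (toℕ-fromℕ< (m%n<n t m)))))
    where
    s = toℕ b + toℕ b
    t = toℕ a + toℕ c

  rescale-injective : ∀ k .{{_ : NonZero k}} i (a c : ℤ/ m) → i + toℕ a * k ≡ i + toℕ c * k → a ≡ c
  rescale-injective k i a c eq =
    toℕ-injective (*-cancelʳ-≡ (toℕ a) (toℕ c) k (+-cancelˡ-≡ i (toℕ a * k) (toℕ c * k) eq))

  rescale< : ∀ {k i} (a : ℤ/ m) → i < k → i + toℕ a * k < m * k
  rescale< {k} a i<k = <-≤-trans (+-monoˡ-< (toℕ a * k) i<k) (*-monoˡ-≤ k (toℕ<n a))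

  -- A point of `S′` with maximal `f` cannot be a midpoint. Ties are harmless, as the hypothesis
  -- gives a strict increase.
  potential⇒reducible : ∀ {d} (S : FinSubset (ℤPow m d)) (f : ℤPow m d → ℕ) →
    (∀ {x y z} → x ∈ S → y ∈ S → z ∈ S → x ≢ z → y ⊕ y ≡ x ⊕ z → f y < f x ⊎ f y < f z) →
    NonMidPointReducible S
  potential⇒reducible S f below S′ S′⊆S (x₀ , x₀∈S′) = y , y∈S′ ,
    λ (x , z , x∈S′ , z∈S′ , x≢z , 2y≡x+z) →
      [ (λ y<x → <⇒≱ y<x (maximal x∈S′)) , (λ y<z → <⇒≱ y<z (maximal z∈S′)) ]′
        (below (S′⊆S x∈S′) (S′⊆S y∈S′) (S′⊆S z∈S′) x≢z 2y≡x+z)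
    where
    y = argmax f x₀ (elements S′)
    maximal : ∀ {x} → x ∈ S′ → f x ≤ f y
    maximal = All.lookup (f[xs]≤f[argmax] x₀ (elements S′))
    y∈S′ : y ∈ S′
    -- `argmax` returns a list element or its default `x₀`, which was chosen in `S′`.
    y∈S′ = [ (λ y≡x₀ → subst (_∈ S′) (sym y≡x₀) x₀∈S′) , id ]′ (argmax-sel f x₀ (elements S′))

module _ (m : ℕ) .{{_ : NonZero m}} (i j : ℕ) where

  InRegion : ℤPow m 2 → Set
  InRegion (a Vec.∷ b Vec.∷ Vec.[]) = Region m (i + toℕ a * 24) (j + toℕ b * 16)

  inRegion? : Decidable InRegion
  inRegion? (a Vec.∷ b Vec.∷ Vec.[]) = region? m (i + toℕ a * 24) (j + toℕ b * 16)

  -- The row coordinate comes first, so that the enumeration in `section` runs row by row, in the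
  -- order of the double sums.
  point : ℤ/ m → ℤ/ m → ℤPow m 2
  point b a = a Vec.∷ b Vec.∷ Vec.[]

  point-injective : ∀ {b b′ a a′} → point b a ≡ point b′ a′ → b ≡ b′ × a ≡ a′
  point-injective refl = refl , refl

  section : FinSubset (ℤPow m 2)
  section = record
    { elements = filter inRegion? (cartesianProductWith point (allFin m) (allFin m))
    ; unique = Unique.filter⁺ inRegion?
        (Unique.cartesianProductWith⁺ point point-injective (Unique.allFin⁺ m) (Unique.allFin⁺ m))
    }

  section-size : ∣ section ∣ ≡ Σ< m (λ b → Σ< m (λ a → ⟦ region? m (i + a * 24) (j + b * 16) ⟧))
  section-size = length-filter-product inRegion? point id id
    (λ b a → ⟦ region? m (i + a * 24) (j + b * 16) ⟧) (λ _ _ → refl)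

  sectionHeight : ℤPow m 2 → ℕ
  sectionHeight (a Vec.∷ b Vec.∷ Vec.[]) = height m (i + toℕ a * 24) (j + toℕ b * 16)

  section-reducible : i < 24 → j < 16 → NonMidPointReducible section
  section-reducible i<24 j<16 = potential⇒reducible section sectionHeight below
    where
    inside : ∀ {x} → x ∈ section → InRegion x
    inside x∈ = proj₂ (∈-filter⁻ inRegion? {xs = cartesianProductWith point (allFin m) (allFin m)} x∈)
    below : ∀ {x y z} → x ∈ section → y ∈ section → z ∈ section → x ≢ z → y ⊕ y ≡ x ⊕ z →
      sectionHeight y < sectionHeight x ⊎ sectionHeight y < sectionHeight z
    below {a Vec.∷ b Vec.∷ Vec.[]} {a′ Vec.∷ b′ Vec.∷ Vec.[]} {a″ Vec.∷ b″ Vec.∷ Vec.[]} x∈ y∈ z∈ x≢z 2y≡x+z =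
      midpoint-below m {i + toℕ a * 24} {i + toℕ a′ * 24} {i + toℕ a″ * 24}
        {j + toℕ b * 16} {j + toℕ b′ * 16} {j + toℕ b″ * 16}
        (proj₁ columns) (proj₁ (proj₂ columns)) (proj₁ rows) (proj₁ (proj₂ rows))
        (rescale< a i<24) (rescale< a′ i<24) (rescale< a″ i<24) (rescale< b′ j<16)
        (inside x∈) (inside y∈) (inside z∈)
        (λ (a≡ , b≡) → x≢z (cong₂ (λ b a → point b a) (rescale-injective 16 j b b″ b≡) (rescale-injective 24 i a a″ a≡)))
        (proj₂ (proj₂ columns)) (proj₂ (proj₂ rows))
      where
      columns = +ₘ-rescale 24 i a a′ a″ (cong Vec.head 2y≡x+z)
      rows = +ₘ-rescale 16 j b b′ b″ (cong (Vec.head ∘ Vec.tail) 2y≡x+z)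

-- Averaging over the translates

module _ (m : ℕ) .{{_ : NonZero m}} where

  -- The translates partition the grid, so `Σ-residues` reassembles first the columns and then the
  -- rows.
  total-section-size : Σ< 16 (λ j → Σ< 24 (λ i → ∣ section m i j ∣)) ≡ Σ< (m * 16) (row m)
  total-section-size = begin
    Σ< 16 (λ j → Σ< 24 (λ i → ∣ section m i j ∣))
      ≡⟨ Σ-cong 16 (λ j → trans (Σ-cong 24 (λ i → section-size m i j))
           (Σ-swap 24 m (λ i b → Σ< m (λ a → ⟦ region? m (i + a * 24) (j + b * 16) ⟧)))) ⟩
    Σ< 16 (λ j → Σ< m (λ b → Σ< 24 (λ i → Σ< m (λ a → ⟦ region? m (i + a * 24) (j + b * 16) ⟧))))
      ≡⟨ Σ-cong 16 (λ j → Σ-cong m (λ b → Σ-residues 24 m (λ x → ⟦ region? m x (j + b * 16) ⟧))) ⟩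
    Σ< 16 (λ j → Σ< m (λ b → row m (j + b * 16)))
      ≡⟨ Σ-residues 16 m (row m) ⟩
    Σ< (m * 16) (row m) ∎
    where open ≡-Reasoning

  large-section : ∃₂ λ i j → i < 24 × j < 16 × 7 * m ^ 2 ≤ 24 * ∣ section m i j ∣
  large-section =
    -- The arguments 15 and 23 are predecessors of the numbers of row and column offsets.
    let j , i , j<16 , i<24 , total≤ = Σ-≤-max₂ 15 23 (λ j i → ∣ section m i j ∣)
    in i , j , i<24 , j<16 , *-cancelˡ-≤ 16 (begin
      16 * (7 * m ^ 2)                               ≡⟨ 16*7m²≡m²*112 m ⟩
      m * m * 112                                    ≤⟨ region-size m ⟩
      Σ< (m * 16) (row m)                            ≡⟨ total-section-size ⟨
      Σ< 16 (λ j → Σ< 24 (λ i → ∣ section m i j ∣)) ≤⟨ total≤ ⟩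
      16 * (24 * ∣ section m i j ∣)                  ∎)
    where
    open ≤-Reasoning
    16*7m²≡m²*112 : ∀ m → 16 * (7 * (m * (m * 1))) ≡ m * m * 112
    16*7m²≡m²*112 m = solve (m ∷ [])

proposition2p5 : (m : ℕ) → .{{_ : NonZero m}} →
    Σ (FinSubset (ℤPow m 2)) λ S →
    NonMidPointReducible S × 7 * m ^ 2 ≤ 24 * ∣ S ∣
proposition2p5 m =
  let i , j , i<24 , j<16 , large = large-section m
  in section m i j , section-reducible m i j i<24 j<16 , large
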